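{- Let $p\geq 3$ and $k\geq 1$ be integers. Let $\mathcal{G}$ be the class of $K_p$-free graphs of treewidth at most $k$. Then the defective chromatic number of $\mathcal{G}$, the clustered chromatic number of $\mathcal{G}$, and the chromatic number of $\mathcal{G}$ are equal.
   Context: Graphs are finite, simple and undirected. A graph is $K_p$-free if it has no subgraph isomorphic to the complete graph $K_p$. A $k$-colouring of a graph assigns one of at most $k$ colours to each vertex (not necessarily properly). A monochromatic component is a connected component of the subgraph induced by all vertices of a single colour. A colouring has defect $d$ if every monochromatic component has maximum degree at most $d$, and has clustering $c$ if every monochromatic component has at most $c$ vertices. For a graph class $\mathcal{G}$: the chromatic number of $\mathcal{G}$ is $\max\{\chi(G):G\in\mathcal{G}\}$, where $\chi(G)$ is the usual (proper) chromatic number; the defective chromatic number of $\mathcal{G}$ is the minimum integer $k$ for which there exists an integer $d$ such that every graph in $\mathcal{G}$ is $k$-colourable with defect $d$; the clustered chromatic number of $\mathcal{G}$ is the minimum integer $k$ for which there exists an integer $c$ such that every graph in $\mathcal{G}$ is $k$-colourable with clustering $c$. (Each is called unbounded if the relevant maximum or minimum does not exist.) Treewidth is the minimum, over all tree-decompositions, of the maximum bag size minus one. -}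

module Defs where

open import Data.Nat.Base using (ℕ; _+_; _∸_; _≤_)
open import Data.Fin.Base using (Fin; zero; suc; inject₁; fromℕ)
open import Data.Fin.Properties using (_≟_)
open import Data.Fin.Subset using (Subset; _∈_; ⊤; ∣_∣; _∩_; Nonempty)
open import Data.Fin.Subset.Properties using (_∈?_)
import Data.List.Base as List
open import Data.List.Extrema.Nat using (max)
open import Data.Product.Base using (∃-syntax; _×_)
open import Data.Vec.Base using (tabulate)
open import Function.Base using (_∘_)
open import Function.Bundles using (_⇔_)
open import Function.Definitions using (Injective)
open import Level using (Level; 0ℓ) renaming (suc to lsuc)
open import Relation.Binary.Core using (Rel)
open import Relation.Binary.Definitions using (Decidable; Symmetric)
open import Relation.Binary.Construct.Closure.ReflexiveTransitive using (Star)
open import Relation.Binary.PropositionalEquality using (_≡_; _≢_; refl; sym)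
open import Relation.Nullary using (¬_; ¬?; does)
open import Relation.Unary using (Pred)
import Relation.Unary as Unary

private
  variable
    ℓ : Level

IsMinimum : Pred ℕ ℓ → Pred ℕ ℓ
IsMinimum P n = P n × (∀ m → P m → n ≤ m)

IsMaximum : Pred ℕ ℓ → Pred ℕ ℓ
IsMaximum P n = P n × (∀ m → P m → m ≤ n)

⟪_⟫ : ∀ {n} {P : Pred (Fin n) ℓ} → Unary.Decidable P → Subset n
⟪ P? ⟫ = tabulate (does ∘ P?)

record Graph : Set₁ where
  field
    order : ℕ

  Vertex : Set
  Vertex = Fin order

  infix 4 _~_ _~?_
  field
    _~_      : Rel Vertex 0ℓ
    _~?_     : Decidable _~_
    ~-sym    : Symmetric _~_
    ~-irrefl : ∀ {v} → ¬ (v ~ v)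

  neighbours : Vertex → Subset order
  neighbours v = ⟪ (λ w → v ~? w) ⟫

  -- Adjacency in the subgraph induced by X.
  Induced : Subset order → Rel Vertex 0ℓ
  Induced X u v = u ∈ X × v ∈ X × u ~ v

  InducesConnected : Pred (Subset order) 0ℓ
  InducesConnected X =
    Nonempty X × (∀ {u v} → u ∈ X → v ∈ X → Star (Induced X) u v)

  -- S is the vertex set of a connected component of the subgraph
  -- induced by X.
  IsComponentOf : Subset order → Pred (Subset order) 0ℓ
  IsComponentOf X S = ∃[ v ] v ∈ X × (∀ w → w ∈ S ⇔ Star (Induced X) v w)

  MaxDegree≤ : ℕ → Pred (Subset order) 0ℓ
  MaxDegree≤ d S = ∀ {v} → v ∈ S → ∣ neighbours v ∩ S ∣ ≤ d

  -- A cycle of length 3 + m, closed up by the edge from its last vertex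
  -- to its first.
  Cycle : Set
  Cycle = ∃[ m ] ∃[ c ]
    Injective _≡_ _≡_ c
    × (∀ (i : Fin (2 + m)) → c (inject₁ i) ~ c (suc i))
    × c (fromℕ (2 + m)) ~ c zero

  IsTree : Set
  IsTree = InducesConnected ⊤ × ¬ Cycle

  Colouring : ℕ → Set
  Colouring k = Vertex → Fin k

  IsProper : ∀ {k} → Pred (Colouring k) 0ℓ
  IsProper f = ∀ {u v} → u ~ v → f u ≢ f v

  colourClass : ∀ {k} → Colouring k → Fin k → Subset order
  colourClass f i = ⟪ (λ v → f v ≟ i) ⟫

  IsMonochromaticComponent : ∀ {k} → Colouring k → Pred (Subset order) 0ℓ
  IsMonochromaticComponent f S = ∃[ i ] IsComponentOf (colourClass f i) S

  HasDefect : ∀ {k} → ℕ → Pred (Colouring k) 0ℓ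
  HasDefect d f = ∀ S → IsMonochromaticComponent f S → MaxDegree≤ d S

  HasClustering : ∀ {k} → ℕ → Pred (Colouring k) 0ℓ
  HasClustering c f = ∀ S → IsMonochromaticComponent f S → ∣ S ∣ ≤ c

  IsChromaticNumber : Pred ℕ 0ℓ
  IsChromaticNumber = IsMinimum λ k → ∃[ f ] IsProper {k} f

open Graph

K : ℕ → Graph
K p = record
  { order    = p
  ; _~_      = _≢_
  ; _~?_     = λ u v → ¬? (u ≟ v)
  ; ~-sym    = λ u≢v v≡u → u≢v (sym v≡u)
  ; ~-irrefl = λ v≢v → v≢v refl
  }

-- G has a (not necessarily induced) subgraph isomorphic to H.
_⊑_ : Rel Graph 0ℓ
H ⊑ G = ∃[ φ ] Injective _≡_ _≡_ φ × (∀ {u v} → _~_ H u v → _~_ G (φ u) (φ v))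

_-Free : ℕ → Pred Graph 0ℓ
(p -Free) G = ¬ (K p ⊑ G)

record TreeDecomposition (G : Graph) : Set₁ where
  field
    tree   : Graph
    isTree : IsTree tree
    bag    : Vertex tree → Subset (order G)

  nodesContaining : Vertex G → Subset (order tree)
  nodesContaining v = ⟪ (λ t → v ∈? bag t) ⟫

  field
    edge-covered     : ∀ {u v} → _~_ G u v → ∃[ t ] u ∈ bag t × v ∈ bag t
    vertex-connected : ∀ v → InducesConnected tree (nodesContaining v)

  -- The subtraction truncates only when every bag is empty, that is, for
  -- the graph without vertices, which then gets width 0 instead of −1.
  width : ℕ
  width = max 0 (List.tabulate (λ t → ∣ bag t ∣)) ∸ 1

-- A minimum is at most k exactly when some attained value is.
Treewidth≤ : ℕ → Pred Graph (lsuc 0ℓ)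
Treewidth≤ k G = ∃[ D ] TreeDecomposition.width {G} D ≤ k

GraphClass : Set₂
GraphClass = Pred Graph (lsuc 0ℓ)

-- "n is the … chromatic number of 𝒢".  These are relations because the
-- minimum or maximum need not exist (the unbounded case).

IsClassChromaticNumber : GraphClass → Pred ℕ (lsuc 0ℓ)
IsClassChromaticNumber 𝒢 =
  IsMaximum λ n → ∃[ G ] 𝒢 G × IsChromaticNumber G n

IsDefectiveChromaticNumber : GraphClass → Pred ℕ (lsuc 0ℓ)
IsDefectiveChromaticNumber 𝒢 =
  IsMinimum λ k → ∃[ d ] (∀ G → 𝒢 G → ∃[ f ] HasDefect G {k} d f)

IsClusteredChromaticNumber : GraphClass → Pred ℕ (lsuc 0ℓ)
IsClusteredChromaticNumber 𝒢 =
  IsMinimum λ k → ∃[ c ] (∀ G → 𝒢 G → ∃[ f ] HasClustering G {k} c f)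

KFreeOfTreewidth≤ : (p k : ℕ) → GraphClass
KFreeOfTreewidth≤ p k G = (p -Free) G × Treewidth≤ k G

{-# OPTIONS --safe #-}
module Submission where

-- Play a game on k + 1 slots: the presenter puts a new vertex into a slot and
-- joins it to some of the other slots without creating a K_p, and the colourer
-- answers with a colour that differs from those of the chosen neighbours.
-- There are finitely many positions, so for some j surviving j moves from a
-- position implies surviving j + 1, hence surviving for ever.
--
-- If the colourer with m colours survives from the empty position, then every
-- graph of the class is properly m-colourable: order the vertices by the depth
-- of their topmost node in the tree decomposition and answer them one by one.
-- Otherwise, for each d, the graph that realises all plays of length j with
-- sufficiently many copies of every vertex is in the class and has no
-- m-colouring of defect d: among the copies of a vertex at least one would
-- avoid the colours of its earlier neighbours, so the colouring would
-- yield a strategy for the colourer.  Hence all three numbers are the least m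
-- for which the colourer wins.

open import Defs
open import Data.Bool.Base using (true)
open import Data.Empty using (⊥; ⊥-elim)
open import Data.Fin.Base
  using (Fin; zero; suc; toℕ; fromℕ; inject₁; inject≤; punchIn; combine; remQuot; finToFun; funToFin)
import Data.Fin.Properties as Fin
open import Data.Fin.Relation.Unary.Top using (view; ‵fromℕ; ‵inject₁)
open import Data.Fin.Subset
  using (Subset; _∈_; _∉_; _⊂_; ⊤; ⁅_⁆; ∣_∣; _-_; _∩_; ∁; inside; outside)
open import Data.Fin.Subset.Properties
  using ( _∈?_; ∈⊤; x∈⁅x⁆; x∈p∩q⁺; x∈p∩q⁻; x∈∁p⇒x∉p; x∈p∧x≢y⇒x∈p-y; Empty-unique
        ; ∣⊤∣≡n; ∣⊥∣≡0; ∣⁅x⁆∣≡1; ∣p∩q∣≤∣q∣; p⊆q⇒∣p∣≤∣q∣; p⊂q⇒∣p∣<∣q∣; x∈p⇒∣p-x∣<∣p∣)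
open import Data.List.Base as List using (List; []; _∷_; length)
open import Data.List.Extrema.Nat using (max≤v⁺; xs≤max)
import Data.List.Properties as List
import Data.List.Relation.Unary.All.Properties as All
open import Data.Nat.Base
  using (ℕ; zero; suc; _+_; _*_; _^_; _≤_; _<_; z≤n; s≤s; s≤s⁻¹)
open import Data.Nat.Induction using (<-wellFounded; Acc; acc)
import Data.Nat.Properties as ℕ
open import Data.Product.Base using (∃-syntax; _×_; _,_; proj₁; proj₂; uncurry)
open import Data.Product.Function.NonDependent.Propositional using (_×-↔_)
open import Data.Product.Properties using (,-injectiveʳ) renaming (≡-dec to ×-≡-dec)
open import Data.Sum.Base using (_⊎_; inj₁; inj₂; [_,_]′; reduce; swap)
open import Data.Unit.Base using (tt) renaming (⊤ to Unit)
open import Data.Vec.Base using ([]; _∷_; here; there)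
open import Data.Vec.Functional using (updateAt)
open import Data.Vec.Functional.Properties using (updateAt-updates; updateAt-minimal)
open import Data.Vec.Properties using (lookup∘tabulate; []=⇒lookup; lookup⇒[]=)
open import Effect.Monad using (RawMonad)
open import Function.Base using (_∘_; id; const; case_of_)
open import Function.Bundles using (_↔_; Inverse; mk⇔; Equivalence)
open import Function.Definitions using (Injective)
open import Function.Properties.Inverse using (↔-refl; ↔-trans)
open import Level using (Level; 0ℓ)
open import Relation.Binary.Construct.Closure.ReflexiveTransitive as Star using (Star; ε; _◅_; _◅◅_)
open import Relation.Binary.Core using (Rel)
open import Relation.Binary.Definitions
  using (DecidableEquality; Total; Transitive; tri<; tri≈; tri>)
import Relation.Binary.Definitions as Binary
open import Relation.Binary.PropositionalEquality
  using (_≡_; _≢_; refl; sym; trans; cong; cong₂; subst; subst₂)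
open import Relation.Nullary
  using (¬_; Dec; yes; no; does; ¬?; contradiction; _×-dec_; _⊎-dec_; _→-dec_; map′)
open import Relation.Nullary.Decidable using (dec-true; decidable-stable; ¬¬-excluded-middle)
open import Relation.Nullary.Negation using (¬¬-Monad)
open import Relation.Unary using (Pred; Decidable)

private
  variable
    ℓ : Level
    a n : ℕ

-- Subsets given by decidable predicates, and counting.

does-true : {P : Set ℓ} (P? : Dec P) → does P? ≡ true → P
does-true (yes p) _ = p

⟪⟫⁺ : {P : Pred (Fin n) ℓ} (P? : Decidable P) {v : Fin n} → P v → v ∈ ⟪ P? ⟫
⟪⟫⁺ P? {v} p = lookup⇒[]= v _ (trans (lookup∘tabulate (does ∘ P?) v) (dec-true (P? v) p))

⟪⟫⁻ : {P : Pred (Fin n) ℓ} (P? : Decidable P) {v : Fin n} → v ∈ ⟪ P? ⟫ → P v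
⟪⟫⁻ P? {v} v∈ = does-true (P? v) (trans (sym (lookup∘tabulate (does ∘ P?) v)) ([]=⇒lookup v∈))

-- The image of each element is removed from `X` before the next is treated; injectivity keeps the
-- images of the others available.
∣∣-injective-≤ : (Y : Subset a) (X : Subset n) (R : Fin a → Fin n → Set ℓ) →
  (∀ {y} → y ∈ Y → ∃[ x ] x ∈ X × R y x) →
  (∀ {y y′ x} → R y x → R y′ x → y ≡ y′) →
  ∣ Y ∣ ≤ ∣ X ∣
∣∣-injective-≤ []            X R img inj = z≤n
∣∣-injective-≤ (outside ∷ Y) X R img inj =
  ∣∣-injective-≤ Y X (R ∘ suc) (img ∘ there) λ r r′ → Fin.suc-injective (inj r r′)
∣∣-injective-≤ (inside ∷ Y)  X R img inj with x₀ , x₀∈X , r₀ ← img here =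
  ℕ.≤-<-trans
    (∣∣-injective-≤ Y (X - x₀) (R ∘ suc) img′ λ r r′ → Fin.suc-injective (inj r r′))
    (x∈p⇒∣p-x∣<∣p∣ x₀∈X)
  where
  img′ : ∀ {y} → y ∈ Y → ∃[ x ] x ∈ X - x₀ × R (suc y) x
  img′ y∈Y with x , x∈X , r ← img (there y∈Y) =
    x , x∈p∧x≢y⇒x∈p-y x∈X (λ { refl → contradiction (inj r₀ r) λ () }) , r

∣∣≤0⇒∉ : (X : Subset n) → ∣ X ∣ ≤ 0 → ∀ {x} → ¬ x ∈ X
∣∣≤0⇒∉ X ∣X∣≤0 x∈X = ℕ.<⇒≱ (x∈p⇒∣p-x∣<∣p∣ x∈X) (ℕ.≤-trans ∣X∣≤0 z≤n)

∣∣-split-≤ : ∀ (P Q : Subset n) → ∣ P ∣ ≤ ∣ Q ∣ + ∣ P ∩ ∁ Q ∣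
∣∣-split-≤ []            []            = z≤n
∣∣-split-≤ (inside ∷ P)  (inside ∷ Q)  = s≤s (∣∣-split-≤ P Q)
∣∣-split-≤ (inside ∷ P)  (outside ∷ Q) = subst (suc ∣ P ∣ ≤_) (sym (ℕ.+-suc _ _)) (s≤s (∣∣-split-≤ P Q))
∣∣-split-≤ (outside ∷ P) (inside ∷ Q)  = ℕ.m≤n⇒m≤1+n (∣∣-split-≤ P Q)
∣∣-split-≤ (outside ∷ P) (outside ∷ Q) = ∣∣-split-≤ P Q

-- Pigeonhole, peeling off one class at a time: at most `d` members are related to `zero`, and the
-- remaining `k` classes cover the others.
∣∣-covering-≤ : ∀ {k} {R : Fin n → Fin k → Set ℓ} (R? : ∀ x t → Dec (R x t)) d →
  (∀ t → ∣ ⟪ (λ x → R? x t) ⟫ ∣ ≤ d) →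
  (X : Subset n) → (∀ {x} → x ∈ X → ∃[ t ] R x t) → ∣ X ∣ ≤ k * d
∣∣-covering-≤ {n = n} {k = zero} R? d small X cover =
  ℕ.≤-reflexive (trans (cong ∣_∣ (Empty-unique λ { (_ , x∈X) → contradiction (proj₁ (cover x∈X)) λ () })) (∣⊥∣≡0 n))
∣∣-covering-≤ {k = suc k} {R} R? d small X cover = begin
  ∣ X ∣           ≤⟨ ∣∣-split-≤ X X₀ ⟩
  ∣ X₀ ∣ + ∣ X₁ ∣ ≤⟨ ℕ.+-mono-≤ (small zero) (∣∣-covering-≤ (λ x t → R? x (suc t)) d (small ∘ suc) X₁ cover′) ⟩
  d + k * d       ∎
  where
  open ℕ.≤-Reasoning
  X₀ = ⟪ (λ x → R? x zero) ⟫
  X₁ = X ∩ ∁ X₀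
  cover′ : ∀ {x} → x ∈ X₁ → ∃[ t ] R x (suc t)
  cover′ x∈X₁ with x∈X , x∈∁ ← x∈p∩q⁻ X (∁ X₀) x∈X₁ | cover (proj₁ (x∈p∩q⁻ X (∁ X₀) x∈X₁))
  ... | zero  , r = contradiction (⟪⟫⁺ (λ x → R? x zero) r) (x∈∁p⇒x∉p x∈∁)
  ... | suc t , r = t , r

-- Least and extremal elements, stabilising sequences.

least : {P : Pred ℕ ℓ} → Decidable P → ∀ n → P n → ∃[ m ] IsMinimum P m
least P? n p with P? 0
least P? n       p | yes p₀ = 0 , p₀ , λ _ _ → z≤n
least P? zero    p | no ¬p₀ = contradiction p ¬p₀
least {P = P} P? (suc n) p | no ¬p₀ with m , pm , min ← least (P? ∘ suc) n p =
  suc m , pm , λ { zero p₀ → contradiction p₀ ¬p₀ ; (suc i) pi → s≤s (min i pi) }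

extremum : ∀ {A : Set} {_≼_ : Rel A ℓ} → Total _≼_ → Transitive _≼_ →
  (f : Fin n → A) {P : Pred (Fin n) ℓ} → Decidable P →
  (∃[ i ] P i × (∀ j → P j → f i ≼ f j)) ⊎ (∀ i → ¬ P i)
extremum {n = zero} _ _ _ _ = inj₂ λ ()
extremum {n = suc n} {_≼_ = _≼_} total tr f {P} P?
  with P? zero | extremum total tr (f ∘ suc) (P? ∘ suc)
... | no ¬p | inj₂ none = inj₂ λ { zero → ¬p ; (suc i) → none i }
... | no ¬p | inj₁ (i , pi , ext) = inj₁ (suc i , pi , λ { zero p → contradiction p ¬p ; (suc j) → ext j })
-- Totality applied to an element and itself supplies reflexivity.
... | yes p | inj₂ none = inj₁ (zero , p , λ { zero _ → reduce (total _ _) ; (suc j) pj → contradiction pj (none j) })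
... | yes p | inj₁ (i , pi , ext) with total (f zero) (f (suc i))
...   | inj₂ q = inj₁ (suc i , pi , λ { zero _ → q ; (suc j) → ext j })
...   | inj₁ q = inj₁ (zero , p , λ { zero _ → reduce (total _ _) ; (suc j) pj → tr q (ext j pj) })

argmax : (f : Fin n → ℕ) {P : Pred (Fin n) _} → Decidable P →
  (∃[ i ] P i × (∀ j → P j → f j ≤ f i)) ⊎ (∀ i → ¬ P i)
argmax = extremum (λ x y → ℕ.≤-total y x) (λ p q → ℕ.≤-trans q p)

argmin : (f : Fin n → ℕ) {P : Pred (Fin n) _} → Decidable P →
  (∃[ i ] P i × (∀ j → P j → f i ≤ f j)) ⊎ (∀ i → ¬ P i)
argmin = extremum ℕ.≤-total ℕ.≤-trans

bounded : (f : Fin n → ℕ) → ∃[ b ] (∀ i → f i < b)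
bounded {n = zero}  f = 0 , λ ()
bounded {n = suc n} f with b , f<b ← bounded (f ∘ suc) =
  suc (f zero) + b , λ { zero → s≤s (ℕ.m≤m+n _ b) ; (suc i) → ℕ.<-≤-trans (f<b i) (ℕ.m≤n+m b _) }

-- The sets `P j` decrease, and each failure of stability makes the next one strictly smaller;
-- `fuel` bounds the cardinality still available.
stabilises : (P : ℕ → Pred (Fin n) ℓ) → (∀ j → Decidable (P j)) →
  (∀ j {i} → P (suc j) i → P j i) →
  ∃[ j ] (∀ i → P j i → P (suc j) i)
stabilises P P? anti = go _ 0 ℕ.≤-refl
  where
  go : ∀ fuel j → ∣ ⟪ P? j ⟫ ∣ ≤ fuel → ∃[ j ] (∀ i → P j i → P (suc j) i)
  go fuel j ∣P∣≤ with Fin.all? (λ i → P? j i →-dec P? (suc j) i)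
  ... | yes stable = j , stable
  ... | no unstable
    with i , bad ← Fin.¬∀⟶∃¬ _ _ (λ i → P? j i →-dec P? (suc j) i) unstable
    with fuel
  ...   | zero  = contradiction (λ p → ⊥-elim (∣∣≤0⇒∉ _ ∣P∣≤ (⟪⟫⁺ (P? j) p))) bad
  ...   | suc fuel = go fuel (suc j) (s≤s⁻¹ (ℕ.<-≤-trans (p⊂q⇒∣p∣<∣q∣ shrinks) ∣P∣≤))
    where
    shrinks : ⟪ P? (suc j) ⟫ ⊂ ⟪ P? j ⟫
    shrinks = (λ x∈ → ⟪⟫⁺ (P? j) (anti j (⟪⟫⁻ (P? (suc j)) x∈)))
            , i
            , ⟪⟫⁺ (P? j) (decidable-stable (P? j i) λ ¬p → bad λ p → contradiction p ¬p)
            , λ i∈ → bad (λ _ → ⟪⟫⁻ (P? (suc j)) i∈)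

-- Paths, cycles, monochromatic components and distances in a graph.

module GraphProperties (G : Graph) where
  open Graph G

  Avoiding : Vertex → Vertex → Vertex → Set
  Avoiding y u v = u ≢ y × v ≢ y × u ~ v

  record PathAvoiding (y a b : Vertex) : Set where
    field
      steps     : ℕ
      at        : Fin (suc steps) → Vertex
      start     : at zero ≡ a
      end       : at (fromℕ steps) ≡ b
      injective : Injective _≡_ _≡_ at
      adjacent  : ∀ i → at (inject₁ i) ~ at (suc i)
      avoids    : ∀ i → at i ≢ y

  open PathAvoiding

  suffix : ∀ {y a b} (P : PathAvoiding y a b) i → PathAvoiding y (at P i) b
  suffix P zero = record { PathAvoiding P ; start = refl }
  suffix {b = b} record { steps = suc l ; at = at ; end = end ; injective = injective
                ; adjacent = adjacent ; avoids = avoids } (suc i) = suffix tail i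
    where
    tail : PathAvoiding _ (at (suc zero)) b
    tail = record
      { steps = l ; at = at ∘ suc ; start = refl ; end = end
      ; injective = Fin.suc-injective ∘ injective
      ; adjacent = adjacent ∘ suc ; avoids = avoids ∘ suc }

  -- Loop erasure: the first vertex is put in front of the path obtained from the rest, unless it
  -- already lies on that path, which is then cut to start there.
  walk⇒path : ∀ {y a b} → a ≢ y → Star (Avoiding y) a b → PathAvoiding y a b
  walk⇒path {a = a} a≢y ε = record
    { steps = 0 ; at = λ _ → a ; start = refl ; end = refl
    ; injective = λ { {zero} {zero} _ → refl } ; adjacent = λ () ; avoids = λ _ → a≢y }
  walk⇒path {y} {a} {b} a≢y ((_ , a′≢y , a~a′) ◅ walk) with walk⇒path a′≢y walk
  ... | P with Fin.any? (λ i → at P i Fin.≟ a)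
  ...   | yes (i , Pi≡a) = subst (λ u → PathAvoiding y u b) Pi≡a (suffix P i)
  ...   | no a∉P = record
    { steps = suc (steps P) ; at = at′ ; start = refl ; end = end P
    ; injective = inj ; adjacent = adj
    ; avoids = λ { zero → a≢y ; (suc i) → avoids P i } }
    where
    at′ : Fin (suc (suc (steps P))) → Vertex
    at′ zero    = a
    at′ (suc i) = at P i
    inj : Injective _≡_ _≡_ at′
    inj {zero}  {zero}  _  = refl
    inj {zero}  {suc j} eq = contradiction (j , sym eq) a∉P
    inj {suc i} {zero}  eq = contradiction (i , eq) a∉P
    inj {suc i} {suc j} eq = cong suc (injective P eq)
    adj : ∀ i → at′ (inject₁ i) ~ at′ (suc i)
    adj zero    = subst (a ~_) (sym (start P)) a~a′
    adj (suc i) = adjacent P i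

  -- The vertex `y` closes a path that avoids it. As `z ≢ z′`, the path has at least two vertices
  -- and the cycle at least three.
  neighbours-linked⇒cycle : ∀ {y z z′} → y ~ z → y ~ z′ → z ≢ z′ → Star (Avoiding y) z z′ → Cycle
  neighbours-linked⇒cycle {y} y~z y~z′ z≢z′ walk
    with walk⇒path (λ { refl → ~-irrefl y~z }) walk
  ... | record { steps = zero ; start = start ; end = end } = contradiction (trans (sym start) end) z≢z′
  ... | P@record { steps = suc l } = l , at′ , inj , adj
      , subst (_~ y) (sym (end P)) (~-sym y~z′)
    where
    at′ : Fin (3 + l) → Vertex
    at′ zero    = y
    at′ (suc i) = at P i
    inj : Injective _≡_ _≡_ at′
    inj {zero}  {zero}  _  = refl
    inj {zero}  {suc j} eq = contradiction (sym eq) (avoids P j)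
    inj {suc i} {zero}  eq = contradiction eq (avoids P i)
    inj {suc i} {suc j} eq = cong suc (injective P eq)
    adj : ∀ i → at′ (inject₁ i) ~ at′ (suc i)
    adj zero    = subst (y ~_) (sym (start P)) y~z
    adj (suc i) = adjacent P i

  Induced-sym : ∀ X {u v} → Induced X u v → Induced X v u
  Induced-sym X (u∈X , v∈X , u~v) = v∈X , u∈X , ~-sym u~v

  -- Every vertex reaches `r` inside `X` along falling ranks, so two vertices are linked through
  -- `r`.
  descent⇒connected : ∀ {X r} (rank : Vertex → ℕ) → r ∈ X →
    (∀ {u} → u ∈ X → u ≡ r ⊎ ∃[ u′ ] u′ ∈ X × u ~ u′ × rank u′ < rank u) →
    InducesConnected X
  descent⇒connected {X} {r} rank r∈X descend =
    (r , r∈X) , λ {u} {v} u∈X v∈X → down u u∈X (<-wellFounded _)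
                  ◅◅ Star.reverse (Induced-sym X) (down v v∈X (<-wellFounded _))
    where
    down : ∀ u → u ∈ X → Acc _<_ (rank u) → Star (Induced X) u r
    down u u∈X (acc rs) with descend u∈X
    ... | inj₁ refl = ε
    ... | inj₂ (u′ , u′∈X , u~u′ , lt) = (u∈X , u′∈X , u~u′) ◅ down u′ u′∈X (rs lt)

  cycle-neighbours : ∀ (C : Cycle) i → let c = proj₁ (proj₂ C) in
    ∃[ j ] ∃[ j′ ] j ≢ j′ × c i ~ c j × c i ~ c j′
  cycle-neighbours (m , c , _ , adj , closing) zero =
    suc zero , fromℕ (2 + m) , (λ ()) , adj zero , ~-sym closing
  cycle-neighbours (m , c , _ , adj , closing) (suc i) with view i
  ... | ‵fromℕ = zero , inject₁ (fromℕ (1 + m)) , (λ ()) , closing , ~-sym (adj (fromℕ (1 + m)))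
  -- An interior vertex of the cycle: the indices of its predecessor and its successor differ by
  -- two.
  ... | ‵inject₁ k = inject₁ (inject₁ k) , suc (suc k)
      , (λ eq → ℕ.m≢1+n+m (toℕ k) {1}
          (trans (sym (trans (Fin.toℕ-inject₁ (inject₁ k)) (Fin.toℕ-inject₁ k))) (cong toℕ eq)))
      , ~-sym (adj (inject₁ k)) , adj (suc k)

  -- Both neighbours on the cycle of a vertex of largest rank have lower rank, so they would
  -- coincide.
  unique-lower-neighbour⇒acyclic : (rank : Vertex → ℕ) →
    (∀ {u v} → u ~ v → rank u ≢ rank v) →
    (∀ {u v w} → u ~ v → u ~ w → rank v < rank u → rank w < rank u → v ≡ w) →
    ¬ Cycle
  unique-lower-neighbour⇒acyclic rank distinct unique C@(m , c , injective , _)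
    with argmax (rank ∘ c) {λ _ → Unit} (λ _ → yes tt)
  ... | inj₂ none = none zero tt
  ... | inj₁ (i , _ , longest) with j , j′ , j≢j′ , i~j , i~j′ ← cycle-neighbours C i =
    j≢j′ (injective (unique i~j i~j′ (lower i~j) (lower i~j′)))
    where
    lower : ∀ {j} → c i ~ c j → rank (c j) < rank (c i)
    lower i~j = ℕ.≤∧≢⇒< (longest _ tt) (distinct (~-sym i~j))

  Star-target : ∀ {X u v} → u ∈ X → Star (Induced X) u v → v ∈ X
  Star-target u∈X ε = u∈X
  Star-target u∈X ((_ , v∈X , _) ◅ walk) = Star-target v∈X walk

  module _ {k} {f : Colouring k} where

    component-colour : ∀ {S} → IsMonochromaticComponent f S → ∃[ i ] (∀ {v} → v ∈ S → f v ≡ i)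
    component-colour (i , v , v∈ , comp) =
      i , λ {w} w∈S → ⟪⟫⁻ (λ v → f v Fin.≟ i) (Star-target v∈ (Equivalence.to (comp w) w∈S))

    proper⇒HasDefect-0 : IsProper f → HasDefect 0 f
    proper⇒HasDefect-0 proper S comp {v} v∈S with i , mono ← component-colour comp =
      ℕ.≤-reflexive (trans (cong ∣_∣ (Empty-unique λ (w , w∈) →
        let w∈N , w∈S = x∈p∩q⁻ (neighbours v) S w∈
        in proper (⟪⟫⁻ (λ w → v ~? w) w∈N) (trans (mono v∈S) (sym (mono w∈S))))) (∣⊥∣≡0 order))

    proper⇒HasClustering-1 : IsProper f → HasClustering 1 f
    proper⇒HasClustering-1 proper S (i , v , v∈ , comp) =
      subst (∣ S ∣ ≤_) (∣⁅x⁆∣≡1 v) (p⊆q⇒∣p∣≤∣q∣ λ {w} w∈S → only (Equivalence.to (comp w) w∈S))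
      where
      class? = λ v → f v Fin.≟ i
      only : ∀ {w} → Star (Induced (colourClass f i)) v w → w ∈ ⁅ v ⁆
      only ε = x∈⁅x⁆ v
      only ((u∈ , w∈ , u~w) ◅ _) = contradiction (trans (⟪⟫⁻ class? u∈) (sym (⟪⟫⁻ class? w∈))) (proper u~w)

    HasClustering⇒HasDefect : ∀ {c} → HasClustering c f → HasDefect c f
    HasClustering⇒HasDefect clustered S comp {v} v∈S =
      ℕ.≤-trans (∣p∩q∣≤∣q∣ (neighbours v) S) (clustered S comp)

    -- Reachability is decidable only after a search, so the component of v is
    -- produced under a double negation, which the decidable goal absorbs.
    monochromatic-degree-≤ : ∀ {d} → HasDefect d f → ∀ v →
      ∣ ⟪ (λ u → (v ~? u) ×-dec (f u Fin.≟ f v)) ⟫ ∣ ≤ d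
    monochromatic-degree-≤ {d} defect v = decidable-stable (_ ℕ.≤? d) λ >d →
      Fin.sequence (RawMonad.rawApplicative ¬¬-Monad) (λ w → ¬¬-excluded-middle {A = Reach w})
        λ reach? → >d (ℕ.≤-trans (p⊆q⇒∣p∣≤∣q∣ (within reach?))
          (defect ⟪ reach? ⟫ (f v , v , v∈ , λ w → mk⇔ (⟪⟫⁻ reach?) (⟪⟫⁺ reach?)) (⟪⟫⁺ reach? ε)))
      where
      X = colourClass f (f v)
      Reach = Star (Induced X) v
      v∈ : v ∈ X
      v∈ = ⟪⟫⁺ (λ u → f u Fin.≟ f v) refl
      within : (reach? : Decidable Reach) → ∀ {u} →
        u ∈ ⟪ (λ u → (v ~? u) ×-dec (f u Fin.≟ f v)) ⟫ → u ∈ neighbours v ∩ ⟪ reach? ⟫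
      within reach? {u} u∈ with v~u , fu≡fv ← ⟪⟫⁻ (λ u → (v ~? u) ×-dec (f u Fin.≟ f v)) u∈ =
        x∈p∩q⁺ ( ⟪⟫⁺ (v ~?_) v~u
               , ⟪⟫⁺ reach? ((v∈ , ⟪⟫⁺ (λ u → f u Fin.≟ f v) fu≡fv , v~u) ◅ ε))

  IsDistanceFrom : Vertex → (Vertex → ℕ) → Set
  IsDistanceFrom r dist =
    (∀ {u} → dist u ≡ 0 → u ≡ r) ×
    (∀ {u n} → dist u ≡ suc n → ∃[ u′ ] u ~ u′ × dist u′ < dist u)

  -- The least length of a walk to `r`. Walks of a fixed length can be searched for, and the second
  -- vertex of a shortest walk is nearer to `r`.
  connected⇒distance : ∀ r → (∀ u → Star (Induced ⊤) u r) → ∃[ dist ] IsDistanceFrom r dist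
  connected⇒distance r reach = dist , zero-dist , suc-dist
    where
    Walk : ℕ → Pred Vertex 0ℓ
    Walk zero    u = u ≡ r
    Walk (suc n) u = ∃[ u′ ] u ~ u′ × Walk n u′
    walk? : ∀ n u → Dec (Walk n u)
    walk? zero    u = u Fin.≟ r
    walk? (suc n) u = Fin.any? λ u′ → (u ~? u′) ×-dec walk? n u′
    walk : ∀ {u} → Star (Induced ⊤) u r → ∃[ n ] Walk n u
    walk ε = 0 , refl
    walk ((_ , _ , u~u′) ◅ s) with n , w ← walk s = suc n , _ , u~u′ , w
    shortest : ∀ u → ∃[ n ] IsMinimum (λ n → Walk n u) n
    shortest u with n , w ← walk (reach u) = least (λ n → walk? n u) n w
    dist : Vertex → ℕ
    dist u = proj₁ (shortest u)
    zero-dist : ∀ {u} → dist u ≡ 0 → u ≡ r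
    zero-dist {u} eq with shortest u
    zero-dist refl | _ , w , _ = w
    suc-dist : ∀ {u n} → dist u ≡ suc n → ∃[ u′ ] u ~ u′ × dist u′ < dist u
    suc-dist {u} eq with shortest u
    suc-dist refl | _ , (u′ , u~u′ , w) , _ = u′ , u~u′ , s≤s (proj₂ (proj₂ (shortest u′)) _ w)

  -- The walk is split at its last visit to `y`, if there is one; what follows that visit avoids
  -- `y`.
  last-exit : ∀ {Y a t} y → t ≢ y → Star (Induced Y) a t →
    (a ≢ y × Star (Avoiding y) a t) ⊎ (∃[ z ] z ∈ Y × y ~ z × Star (Avoiding y) z t)
  last-exit y t≢y ε = inj₁ (t≢y , ε)
  last-exit {a = a} y t≢y ((_ , b∈Y , a~b) ◅ walk) with last-exit y t≢y walk
  ... | inj₂ exit = inj₂ exit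
  ... | inj₁ (b≢y , walk′) with a Fin.≟ y
  ...   | yes refl = inj₂ (_ , b∈Y , a~b , walk′)
  ...   | no a≢y   = inj₁ (a≢y , (a≢y , b≢y , a~b) ◅ walk′)

  module _ (acyclic : ¬ Cycle) {r dist} (isDistance : IsDistanceFrom r dist) where

    -- Distances fall along the way to the root, so after the first step they stay strictly below
    -- that of `y`, and `y` is never met.
    descend : ∀ {u y} → u ≢ y → dist u ≤ dist y → Acc _<_ (dist u) → Star (Avoiding y) u r
    descend {u} {y} u≢y du≤dy (acc rs) with dist u in eq
    ... | zero with refl ← proj₁ isDistance eq = ε
    ... | suc n with u′ , u~u′ , lt ← proj₂ isDistance eq =
      (u≢y , u′≢y , u~u′) ◅ descend u′≢y (ℕ.<⇒≤ du′<dy) (rs (subst (dist u′ <_) eq lt))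
      where
      du′<dy = ℕ.<-≤-trans lt (ℕ.≤-trans (ℕ.≤-reflexive eq) du≤dy)
      u′≢y : u′ ≢ y
      u′≢y refl = ℕ.<-irrefl refl du′<dy

    -- Otherwise y has a cycle through it: inside Y to t, inside X to x, towards
    -- the root, and back down to y through its parent.
    lower-subtree-contains-top : ∀ {X Y t x y} →
      InducesConnected X → InducesConnected Y → t ∈ X → t ∈ Y → x ∈ X → y ∈ Y →
      (∀ y′ → y′ ∈ Y → dist y ≤ dist y′) → dist x ≤ dist y → y ∈ X
    lower-subtree-contains-top {X} {Y} {t} {x} {y} (_ , connX) (_ , connY) t∈X t∈Y x∈X y∈Y top dx≤dy =
      decidable-stable (y ∈? X) λ y∉X → acyclic (cycle y∉X)
      where
      cycle : y ∉ X → Cycle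
      cycle y∉X with dist y in eq
      ... | zero with refl ← proj₁ isDistance eq | refl ← proj₁ isDistance (ℕ.n≤0⇒n≡0 dx≤dy) =
        contradiction x∈X y∉X
      ... | suc n with y′ , y~y′ , dy′<dy ← proj₂ isDistance eq
                  | last-exit y (λ { refl → y∉X t∈X }) (connY y∈Y t∈Y)
      ...   | inj₁ (y≢y , _) = contradiction refl y≢y
      ...   | inj₂ (z , z∈Y , y~z , z⇝t) =
        neighbours-linked⇒cycle y~z y~y′
          (λ { refl → ℕ.<⇒≱ dy′<dy (ℕ.≤-trans (ℕ.≤-reflexive eq) (top _ z∈Y)) })
          (z⇝t ◅◅ Star.map off-y (connX t∈X x∈X)
               ◅◅ descend (λ { refl → y∉X x∈X }) (ℕ.≤-trans dx≤dy (ℕ.≤-reflexive (sym eq))) (<-wellFounded _)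
               ◅◅ Star.reverse (λ (u≢y , v≢y , u~v) → v≢y , u≢y , ~-sym u~v)
                    (descend (λ { refl → ~-irrefl y~y′ }) (ℕ.<⇒≤ dy′<dy) (<-wellFounded _)))
        where
        off-y : ∀ {u v} → Induced X u v → Avoiding y u v
        off-y (u∈X , v∈X , u~v) = (λ { refl → y∉X u∈X }) , (λ { refl → y∉X v∈X }) , u~v

-- Finite sets coded as numbers.

FinSet : ℕ → Set
FinSet n = Fin (2 ^ n)

infix 4 _∋_ _∋?_

_∋_ : ∀ {n} → FinSet n → Fin n → Set
_∋_ {n} x t = finToFun {n = n} x t ≡ suc zero

_∋?_ : ∀ {n} (x : FinSet n) t → Dec (x ∋ t)
_∋?_ {n} x t = finToFun {n = n} x t Fin.≟ suc zero

indicator : {P : Set} → Dec P → Fin 2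
indicator (yes _) = suc zero
indicator (no _)  = zero

opaque
  encode : ∀ {n} {P : Pred (Fin n) 0ℓ} → Decidable P → FinSet n
  encode P? = funToFin (indicator ∘ P?)

  ∋-encode⁺ : ∀ {n} {P : Pred (Fin n) 0ℓ} (P? : Decidable P) {t} → P t → encode P? ∋ t
  ∋-encode⁺ P? {t} p with eq ← Fin.finToFun-funToFin (indicator ∘ P?) t with P? t
  ... | yes _ = eq
  ... | no ¬p = contradiction p ¬p

  ∋-encode⁻ : ∀ {n} {P : Pred (Fin n) 0ℓ} (P? : Decidable P) {t} → encode P? ∋ t → P t
  ∋-encode⁻ P? {t} ∋t with eq ← Fin.finToFun-funToFin (indicator ∘ P?) t with P? t
  ... | yes p = p
  ... | no _  = contradiction (trans (sym ∋t) eq) λ ()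

-- The game of presenter and colourer on `k` slots.

module Game (q k : ℕ) where

  Slot : Set
  Slot = Fin k

  -- A relation on the slots coded as a number, so that positions can be searched exhaustively and
  -- counted by `stabilises`.
  Position : Set
  Position = Fin ((2 ^ k) ^ k)

  -- Adjacency of the vertices held by the slots; the diagonal records which
  -- slots are occupied.
  Edge : Position → Slot → Slot → Set
  Edge A i j = finToFun A i ∋ j

  edge? : ∀ A i j → Dec (Edge A i j)
  edge? A i j = finToFun A i ∋? j

  Occupied : Position → Slot → Set
  Occupied A t = Edge A t t

  -- A new vertex joined to such a clique would complete a clique on `q + 1` vertices, the forbidden
  -- one.
  Clique : Position → FinSet k → Set
  Clique A x = ∃[ φ ]
    (∀ i → x ∋ finToFun {k} {q} φ i × Occupied A (finToFun φ i)) ×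
    (∀ i j → i ≢ j → finToFun φ i ≢ finToFun φ j × Edge A (finToFun {k} {q} φ i) (finToFun φ j))

  clique? : ∀ A x → Dec (Clique A x)
  clique? A x = Fin.any? λ φ →
    Fin.all? (λ i → (x ∋? finToFun φ i) ×-dec edge? A _ _)
    ×-dec Fin.all? λ i → Fin.all? λ j → ¬? (i Fin.≟ j) →-dec ¬? (_ Fin.≟ _) ×-dec edge? A _ _

  -- An illegal choice of neighbours counts as the empty one.
  Near : Position → FinSet k → Slot → Set
  Near A x t = x ∋ t × Occupied A t × ¬ Clique A x

  near? : ∀ A x t → Dec (Near A x t)
  near? A x t = (x ∋? t) ×-dec edge? A t t ×-dec ¬? (clique? A x)

  -- The adjacency after the move: the new vertex displaces whatever `s` held. `new` marks `s` as
  -- occupied, and `out` and `into` are the two directions of its edges.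
  data Moved (A : Position) (s : Slot) (x : FinSet k) : Slot → Slot → Set where
    new : Moved A s x s s
    out : ∀ {j} → j ≢ s → Near A x j → Moved A s x s j
    into : ∀ {i} → i ≢ s → Near A x i → Moved A s x i s
    old : ∀ {i j} → i ≢ s → j ≢ s → Edge A i j → Moved A s x i j

  moved? : ∀ A s x i j → Dec (Moved A s x i j)
  moved? A s x i j with i Fin.≟ s | j Fin.≟ s
  ... | yes refl | yes refl = yes new
  ... | yes refl | no j≢s   = map′ (out j≢s)
    (λ { new           → contradiction refl j≢s
       ; (out _ near)  → near
       ; (into i≢s _)  → contradiction refl i≢s
       ; (old i≢s _ _) → contradiction refl i≢s })
    (near? A x j)
  ... | no i≢s   | yes refl = map′ (into i≢s)
    (λ { new           → contradiction refl i≢s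
       ; (out j≢s _)   → contradiction refl j≢s
       ; (into _ near) → near
       ; (old _ j≢s _) → contradiction refl j≢s })
    (near? A x i)
  ... | no i≢s   | no j≢s   = map′ (old i≢s j≢s)
    (λ { new           → contradiction refl i≢s
       ; (out _ _)     → contradiction refl i≢s
       ; (into _ _)    → contradiction refl j≢s
       ; (old _ _ e)   → e })
    (edge? A i j)

  opaque
    relation : {R : Slot → Slot → Set} → (∀ i j → Dec (R i j)) → Position
    relation R? = funToFin λ i → encode (R? i)

    Edge-relation⁺ : ∀ {R : Slot → Slot → Set} (R? : ∀ i j → Dec (R i j)) {i j} → R i j → Edge (relation R?) i j
    Edge-relation⁺ R? {i} {j} r =
      subst (_∋ j) (sym (Fin.finToFun-funToFin (λ i → encode (R? i)) i)) (∋-encode⁺ (R? i) r)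

    Edge-relation⁻ : ∀ {R : Slot → Slot → Set} (R? : ∀ i j → Dec (R i j)) {i j} → Edge (relation R?) i j → R i j
    Edge-relation⁻ R? {i} {j} e =
      ∋-encode⁻ (R? i) (subst (_∋ j) (Fin.finToFun-funToFin (λ i → encode (R? i)) i) e)

  move : Position → Slot → FinSet k → Position
  move A s x = relation (moved? A s x)

  occupied-move⁻ : ∀ {A s x t} → t ≢ s → Occupied (move A s x) t → Occupied A t
  occupied-move⁻ {A} {s} {x} t≢s occ with Edge-relation⁻ (moved? A s x) occ
  ... | new       = contradiction refl t≢s
  ... | out _ _   = contradiction refl t≢s
  ... | into _ _   = contradiction refl t≢s
  ... | old _ _ e = e

  vacant : Position
  vacant = relation {λ _ _ → ⊥} λ _ _ → no λ ()

  ¬Edge-vacant : ∀ i j → ¬ Edge vacant i j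
  ¬Edge-vacant i j e = Edge-relation⁻ {λ _ _ → ⊥} (λ _ _ → no λ ()) {i} {j} e

  module Colourer (m : ℕ) where

    Colours : Set
    Colours = Fin (m ^ k)

    recolour : Colours → Slot → Fin m → Colours
    recolour c s y = funToFin (updateAt (finToFun c) s (const y))

    recolour-updates : ∀ c s y → finToFun (recolour c s y) s ≡ y
    recolour-updates c s y = trans (Fin.finToFun-funToFin _ s) (updateAt-updates s (finToFun c))

    recolour-minimal : ∀ c {s} y {t} → t ≢ s → finToFun (recolour c s y) t ≡ finToFun c t
    recolour-minimal c {s} y {t} t≢s =
      trans (Fin.finToFun-funToFin _ t) (updateAt-minimal t s (finToFun c) t≢s)

    Allowed : Position → Colours → Slot → FinSet k → Fin m → Set
    Allowed A c s x y = ∀ t → t ≢ s → Near A x t → finToFun c t ≢ y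

    allowed? : ∀ A c s x y → Dec (Allowed A c s x y)
    allowed? A c s x y =
      Fin.all? λ t → ¬? (t Fin.≟ s) →-dec near? A x t →-dec ¬? (finToFun c t Fin.≟ y)

    -- The presenter chooses the slot `s` and the neighbours `x`, the colourer replies with `y`; `j`
    -- counts the rounds to be survived.
    Win : ℕ → Position → Colours → Set
    Win zero    A c = Unit
    Win (suc j) A c = ∀ s x → ∃[ y ] Allowed A c s x y × Win j (move A s x) (recolour c s y)

    win? : ∀ j A c → Dec (Win j A c)
    win? zero    A c = yes tt
    win? (suc j) A c = Fin.all? λ s → Fin.all? λ x → Fin.any? λ y →
      allowed? A c s x y ×-dec win? j (move A s x) (recolour c s y)

    Win-antitone : ∀ j {A c} → Win (suc j) A c → Win j A c
    Win-antitone zero    win = tt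
    Win-antitone (suc j) win s x with y , ok , winto ← win s x = y , ok , Win-antitone j winto

    -- Pairs of a position and a colour assignment are finitely many, so `stabilises` applies to
    -- them. From such a `j` on, each reply can lead back into `Win j`.
    Win-stabilises : ∃[ j ] (∀ {A c} → Win j A c → Win (suc j) A c)
    Win-stabilises with j , stable ← stabilises
        (λ j → uncurry (Win j) ∘ remQuot {(2 ^ k) ^ k} (m ^ k))
        (λ j Ac → win? j _ _) (λ j → Win-antitone j)
      = j , λ {A} {c} → subst (λ Ac → uncurry (Win j) Ac → uncurry (Win (suc j)) Ac)
                              (Fin.remQuot-combine A c) (stable (combine A c))

    -- All slots are vacant, so their common initial colour never matters.
    start : Fin m → Colours
    start y = funToFin {k} (const y)

    WinsFromStart : ℕ → Set
    WinsFromStart j = ∃[ y ] Win j vacant (start y)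

    winsFromStart? : ∀ j → Dec (WinsFromStart j)
    winsFromStart? j = Fin.any? λ y → win? j vacant (start y)

  -- Otherwise choosing for every colour a slot that carries it would inject `suc k` colours into
  -- `k` slots.
  unused-colour : (c : Slot → Fin (suc k)) → ∃[ y ] (∀ t → c t ≢ y)
  unused-colour c with Fin.any? (λ y → Fin.all? λ t → ¬? (c t Fin.≟ y))
  ... | yes found = found
  ... | no none = contradiction (Fin.injective⇒≤ {f = proj₁ ∘ used} injective) (ℕ.<-irrefl refl)
    where
    used : ∀ y → ∃[ t ] c t ≡ y
    used y with Fin.any? (λ t → c t Fin.≟ y)
    ... | yes t = t
    ... | no ¬t = contradiction (y , λ t eq → ¬t (t , eq)) none
    injective : Injective _≡_ _≡_ (proj₁ ∘ used)
    injective {y} {y′} eq = trans (sym (proj₂ (used y))) (trans (cong c eq) (proj₂ (used y′)))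

  -- A colour carried by no slot is always a legal reply. This guarantees that some number of
  -- colours suffices.
  suc-k-colours-win : ∀ j {A c} → Colourer.Win (suc k) j A c
  suc-k-colours-win zero    = tt
  suc-k-colours-win (suc j) {A} {c} s x with y , free ← unused-colour (finToFun c) =
    y , (λ t _ _ → free t) , suc-k-colours-win j

-- Enumeration of the lists of bounded length.

module BoundedLists {A : Set} {n : ℕ} (alphabet : Fin n ↔ A) where
  open Inverse alphabet

  count : ℕ → ℕ
  count zero    = 1
  count (suc h) = suc (n * count h)

  list : ∀ h → Fin (count h) → List A
  list zero    _       = []
  list (suc h) zero    = []
  list (suc h) (suc i) = let l , r = remQuot {n} (count h) i in to l ∷ list h r

  list-surjective : ∀ h {w} → length w ≤ h → ∃[ i ] list h i ≡ w
  list-surjective zero    {[]} _ = zero , refl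
  list-surjective (suc h) {[]} _ = zero , refl
  list-surjective (suc h) {a ∷ w} (s≤s le) with r , eq ← list-surjective h le =
    suc (combine (from a) r) ,
    trans (cong (λ (l , r) → to l ∷ list h r) (Fin.remQuot-combine (from a) r))
          (cong₂ _∷_ (strictlyInverseˡ a) eq)

  list-injective : ∀ h {i j} → list h i ≡ list h j → i ≡ j
  list-injective zero    {zero}  {zero}  _  = refl
  list-injective (suc h) {zero}  {zero}  _  = refl
  list-injective (suc h) {suc i} {suc j} eq =
    cong suc (trans (sym (Fin.combine-remQuot {n} (count h) i)) (trans
      (cong₂ combine (to-injective (List.∷-injectiveˡ eq)) (list-injective h (List.∷-injectiveʳ eq)))
      (Fin.combine-remQuot {n} (count h) j)))
    where
    to-injective : ∀ {l l′} → to l ≡ to l′ → l ≡ l′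
    to-injective {l} {l′} eq = trans (sym (strictlyInverseʳ l)) (trans (cong from eq) (strictlyInverseʳ l′))

  length-list : ∀ h i → length (list h i) ≤ h
  length-list zero    _       = z≤n
  length-list (suc h) zero    = z≤n
  length-list (suc h) (suc i) = s≤s (length-list h _)

-- The universal graph of all plays of length at most `h`.

module Universal (p k copies h : ℕ) where
  open Game (suc p) k

  -- A move of the presenter together with the number of the copy.
  Letter : Set
  Letter = Slot × FinSet k × Fin copies

  -- A play, latest move first. It names both the vertex that its latest move introduces and a node
  -- of the decomposition tree.
  Word : Set
  Word = List Letter

  _≟ʷ_ : DecidableEquality Word
  _≟ʷ_ = List.≡-dec (×-≡-dec Fin._≟_ (×-≡-dec Fin._≟_ Fin._≟_))

  alphabet : Fin (k * (2 ^ k * copies)) ↔ Letter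
  alphabet = ↔-trans Fin.*↔× (↔-refl ×-↔ Fin.*↔×)

  open BoundedLists alphabet

  position : Word → Position
  position []                = vacant
  position ((s , x , _) ∷ w) = move (position w) s x

  -- The occupant of a slot that is still vacant is a dummy.
  occupant : Word → Slot → Word
  occupant []                    = const []
  occupant w₁@((s , _ , _) ∷ w) = updateAt (occupant w) s (const w₁)

  occupant-updates : ∀ {s} {z} w → occupant ((s , z) ∷ w) s ≡ (s , z) ∷ w
  occupant-updates {s} w = updateAt-updates s (occupant w)

  occupant-minimal : ∀ {s} {z} w {t} → t ≢ s → occupant ((s , z) ∷ w) t ≡ occupant w t
  occupant-minimal {s} w {t} = updateAt-minimal t s (occupant w)

  length-occupant : ∀ w t → length (occupant w t) ≤ length w
  length-occupant []      t = z≤n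
  length-occupant w₁@((s , z) ∷ w) t with t Fin.≟ s
  ... | yes refl = ℕ.≤-reflexive (cong length (occupant-updates w))
  ... | no t≢s   = ℕ.≤-trans (ℕ.≤-reflexive (cong length (occupant-minimal w t≢s)))
    (ℕ.m≤n⇒m≤1+n (length-occupant w t))

  occupant≢longer : ∀ {l} w {t} → occupant w t ≢ l ∷ w
  occupant≢longer w {t} eq = ℕ.1+n≰n (subst (λ v → length v ≤ length w) eq (length-occupant w t))

  -- The newest word is longer than all older occupants. Only occupied slots are compared, since
  -- vacant ones share the dummy.
  occupant-injective : ∀ w {i j} → Occupied (position w) i → Occupied (position w) j →
    occupant w i ≡ occupant w j → i ≡ j
  occupant-injective [] {i} occ _ _ = contradiction occ (¬Edge-vacant i i)
  occupant-injective ((s , z) ∷ w) {i} {j} occᵢ occⱼ eq with i Fin.≟ s | j Fin.≟ s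
  ... | yes refl | yes refl = refl
  ... | yes refl | no j≢s = contradiction
    (trans (sym (occupant-minimal w j≢s)) (trans (sym eq) (occupant-updates w))) (occupant≢longer w)
  ... | no i≢s | yes refl = contradiction
    (trans (sym (occupant-minimal w i≢s)) (trans eq (occupant-updates w))) (occupant≢longer w)
  ... | no i≢s | no j≢s = occupant-injective w
    (occupied-move⁻ {position w} i≢s occᵢ) (occupied-move⁻ {position w} j≢s occⱼ)
    (trans (sym (occupant-minimal w i≢s)) (trans eq (occupant-minimal w j≢s)))

  -- Directed from the later vertex to the earlier one, which sits in a slot selected by the latest
  -- move.
  data Linked : Word → Word → Set where
    link : ∀ {s x a w v} t → t ≢ s → Near (position w) x t → v ≡ occupant w t → Linked ((s , x , a) ∷ w) v

  linked? : Binary.Decidable Linked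
  linked? [] v = no λ ()
  linked? ((s , x , a) ∷ w) v =
    map′ (λ (t , t≢s , near , eq) → link t t≢s near eq)
         (λ { (link t t≢s near eq) → t , t≢s , near , eq })
         (Fin.any? λ t → ¬? (t Fin.≟ s) ×-dec near? (position w) x t ×-dec (v ≟ʷ occupant w t))

  linked-length : ∀ {u v} → Linked u v → length v < length u
  linked-length (link {w = w} t _ _ refl) = s≤s (length-occupant w t)

  Adjacent : Word → Word → Set
  Adjacent u v = Linked u v ⊎ Linked v u

  -- Lengths exclude a link from the older word to the newer; for the other direction,
  -- `occupant-injective` identifies the selected slot with `j`.
  adjacent-new⇒near : ∀ {s x a} w {j} → Occupied (position w) j →
    Adjacent ((s , x , a) ∷ w) (occupant w j) → Near (position w) x j
  adjacent-new⇒near {x = x} w occ (inj₁ (link t _ near@(_ , occₜ , _) eq)) =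
    subst (Near (position w) x) (sym (occupant-injective w occ occₜ eq)) near
  adjacent-new⇒near w {j} occ (inj₂ l) =
    contradiction (ℕ.<-≤-trans (linked-length l) (length-occupant w j)) (ℕ.<-asym (ℕ.n<1+n _))

  -- A position misses no edge between its occupants, so a clique of the graph held by the slots is
  -- a `Clique` of the position.
  adjacent⇒edge : ∀ w {i j} → Occupied (position w) i → Occupied (position w) j →
    Adjacent (occupant w i) (occupant w j) → Edge (position w) i j
  adjacent⇒edge [] {i} occ _ _ = contradiction occ (¬Edge-vacant i i)
  adjacent⇒edge ((s , x , _) ∷ w) {i} {j} occᵢ occⱼ adj with i Fin.≟ s | j Fin.≟ s
  ... | yes refl | yes refl = occᵢ
  ... | yes refl | no j≢s = Edge-relation⁺ (moved? (position w) s x) (out j≢s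
    (adjacent-new⇒near w (occupied-move⁻ {position w} j≢s occⱼ)
      (subst₂ Adjacent (occupant-updates w) (occupant-minimal w j≢s) adj)))
  ... | no i≢s | yes refl = Edge-relation⁺ (moved? (position w) s x) (into i≢s
    (adjacent-new⇒near w (occupied-move⁻ {position w} i≢s occᵢ)
      (swap (subst₂ Adjacent (occupant-minimal w i≢s) (occupant-updates w) adj))))
  ... | no i≢s | no j≢s = Edge-relation⁺ (moved? (position w) s x) (old i≢s j≢s
    (adjacent⇒edge w (occupied-move⁻ {position w} i≢s occᵢ) (occupied-move⁻ {position w} j≢s occⱼ)
      (subst₂ Adjacent (occupant-minimal w i≢s) (occupant-minimal w j≢s) adj)))

  word : Fin (count h) → Word
  word = list h

  graph : Graph
  graph = record
    { order    = count h
    ; _~_      = λ u v → Adjacent (word u) (word v)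
    ; _~?_     = λ u v → linked? (word u) (word v) ⊎-dec linked? (word v) (word u)
    ; ~-sym    = swap
    ; ~-irrefl = λ { (inj₁ l) → ℕ.<-irrefl refl (linked-length l)
                   ; (inj₂ l) → ℕ.<-irrefl refl (linked-length l) }
    }

  -- The longest word of a clique is linked to all the others, which therefore
  -- form a smaller clique among the slots that its last letter selects.
  graph-free : (suc (suc p) -Free) graph
  graph-free (φ , φ-injective , clique) with argmax (length ∘ word ∘ φ) {λ _ → Unit} (λ _ → yes tt)
  ... | inj₂ none = none zero tt
  ... | inj₁ (i , _ , longest) = impossible (word (φ i)) linked
    where
    others : Fin (suc p) → Word
    others j = word (φ (punchIn i j))
    linked : ∀ j → Linked (word (φ i)) (others j)
    linked j with clique {i} {punchIn i j} (Fin.punchInᵢ≢i i j ∘ sym)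
    ... | inj₁ l = l
    ... | inj₂ l = contradiction (linked-length l) (ℕ.≤⇒≯ (longest _ tt))
    impossible : ∀ v → ¬ (∀ j → Linked v (others j))
    impossible []                linked = contradiction (linked zero) λ ()
    impossible ((s , x , _) ∷ w) linked = proj₂ (proj₂ (near zero))
      ( funToFin slot
      , (λ j → subst (λ t → x ∋ t × Occupied (position w) t) (sym (Fin.finToFun-funToFin slot j))
                 (proj₁ (near j) , proj₁ (proj₂ (near j))))
      , (λ j j′ j≢j′ → subst₂ (λ t t′ → t ≢ t′ × Edge (position w) t t′)
          (sym (Fin.finToFun-funToFin slot j)) (sym (Fin.finToFun-funToFin slot j′))
          ( (λ eq → j≢j′ (Fin.punchIn-injective i j j′ (φ-injective (list-injective h
              (trans (holds j) (trans (cong (occupant w) eq) (sym (holds j′))))))))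
          , adjacent⇒edge w (proj₁ (proj₂ (near j))) (proj₁ (proj₂ (near j′)))
              (subst₂ Adjacent (holds j) (holds j′) (clique (j≢j′ ∘ Fin.punchIn-injective i j j′))))))
      where
      slotOf : ∀ j → ∃[ t ] Near (position w) x t × others j ≡ occupant w t
      slotOf j with link t _ near eq ← linked j = t , near , eq
      slot = proj₁ ∘ slotOf
      near : ∀ j → Near (position w) x (slot j)
      near = proj₁ ∘ proj₂ ∘ slotOf
      holds : ∀ j → others j ≡ occupant w (slot j)
      holds = proj₂ ∘ proj₂ ∘ slotOf

  -- The tree decomposition of the universal graph.

  data Child : Word → Word → Set where
    child : ∀ {l w} → Child (l ∷ w) w

  child? : Binary.Decidable Child
  child? []      w = no λ ()
  child? (_ ∷ v) w = map′ (λ { refl → child }) (λ { child → refl }) (v ≟ʷ w)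

  tree : Graph
  tree = record
    { order    = count h
    ; _~_      = λ u v → Child (word u) (word v) ⊎ Child (word v) (word u)
    ; _~?_     = λ u v → child? (word u) (word v) ⊎-dec child? (word v) (word u)
    ; ~-sym    = swap
    ; ~-irrefl = λ { (inj₁ c) → ℕ.<-irrefl refl (child-length c)
                   ; (inj₂ c) → ℕ.<-irrefl refl (child-length c) }
    }
    where
    child-length : ∀ {u v} → Child u v → length v < length u
    child-length child = ℕ.≤-refl

  open GraphProperties tree

  rank : Fin (count h) → ℕ
  rank u = length (word u)

  parent : ∀ u → word u ≡ [] ⊎ ∃[ l ] ∃[ v ] word u ≡ l ∷ word v
  parent u with word u in eq
  ... | []    = inj₁ refl
  ... | l ∷ w with v , eq′ ← list-surjective h {w}
                  (ℕ.≤-trans (ℕ.n≤1+n _) (subst (λ w → length w ≤ h) eq (length-list h u))) =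
    inj₂ (l , v , cong (l ∷_) (sym eq′))

  root : Fin (count h)
  root = proj₁ (list-surjective h {[]} z≤n)

  word-root : word root ≡ []
  word-root = proj₂ (list-surjective h {[]} z≤n)

  child-of : ∀ {u l v} → word u ≡ l ∷ word v → Graph._~_ tree u v × rank v < rank u
  child-of {v = v} eq =
      inj₁ (subst (λ w → Child w (word v)) (sym eq) child)
    , subst (λ w → length (word v) < length w) (sym eq) ℕ.≤-refl

  isTree : Graph.IsTree tree
  isTree =
      descent⇒connected {r = root} rank ∈⊤ (λ {u} _ → case parent u of λ
        { (inj₁ eq) → inj₁ (list-injective h (trans eq (sym word-root)))
        ; (inj₂ (_ , v , eq)) → inj₂ (v , ∈⊤ , child-of eq) })
    , unique-lower-neighbour⇒acyclic rank distinct unique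
    where
    distinct′ : ∀ {u v} → Child u v ⊎ Child v u → length u ≢ length v
    distinct′ (inj₁ child) eq = ℕ.1+n≢n eq
    distinct′ (inj₂ child) eq = ℕ.1+n≢n (sym eq)
    distinct : ∀ {u v} → Graph._~_ tree u v → rank u ≢ rank v
    distinct = distinct′
    unique′ : ∀ {u v w} → Child u v ⊎ Child v u → Child u w ⊎ Child w u →
      length v < length u → length w < length u → v ≡ w
    unique′ (inj₁ child) (inj₁ child) _ _ = refl
    unique′ (inj₂ child) _ lt _ = contradiction lt (ℕ.<-asym (ℕ.n<1+n _))
    unique′ _ (inj₂ child) _ lt = contradiction lt (ℕ.<-asym (ℕ.n<1+n _))
    unique : ∀ {u v w} → Graph._~_ tree u v → Graph._~_ tree u w → rank v < rank u → rank w < rank u → v ≡ w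
    unique u~v u~w lt lt′ = list-injective h (unique′ u~v u~w lt lt′)

  Holds : Fin (count h) → Fin (count h) → Set
  Holds u v = ∃[ t ] occupant (word u) t ≡ word v

  holds? : ∀ u v → Dec (Holds u v)
  holds? u v = Fin.any? λ t → occupant (word u) t ≟ʷ word v

  bag : Fin (count h) → Subset (count h)
  bag u = ⟪ holds? u ⟫

  ∣bag∣≤k : ∀ u → ∣ bag u ∣ ≤ k
  ∣bag∣≤k u = subst (∣ bag u ∣ ≤_) (∣⊤∣≡n k)
    (∣∣-injective-≤ (bag u) ⊤ (λ v t → occupant (word u) t ≡ word v)
      (λ v∈ → let t , eq = ⟪⟫⁻ (holds? u) v∈ in t , ∈⊤ , eq)
      (λ eq eq′ → list-injective h (trans (sym eq) eq′)))

  -- Every vertex enters the slots at the node of the same name and then stays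
  -- along downward paths until it is overwritten.
  decomposition : Slot → TreeDecomposition graph
  decomposition t₀ = record
    { tree = tree ; isTree = isTree ; bag = bag
    ; edge-covered = λ { {u} {v} (inj₁ l) → u , own u , linked-covered l
                       ; {u} {v} (inj₂ l) → v , linked-covered l , own v }
    ; vertex-connected = λ v → descent⇒connected rank (⟪⟫⁺ (λ u → v ∈? bag u) (own v)) (λ u∈ →
        ascend v (⟪⟫⁻ (λ u → v ∈? bag u) u∈))
    }
    where
    own′ : ∀ w → ∃[ t ] occupant w t ≡ w
    -- After the empty play every slot holds the dummy, so any slot serves.
    own′ []            = t₀ , refl
    own′ ((s , _) ∷ w) = s , occupant-updates w
    own : ∀ u → u ∈ bag u
    own u = ⟪⟫⁺ (holds? u) (own′ (word u))
    linked-covered′ : ∀ {u v} → Linked u v → ∃[ t ] occupant u t ≡ v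
    linked-covered′ (link {w = w} t t≢s _ eq) = t , trans (occupant-minimal w t≢s) (sym eq)
    linked-covered : ∀ {u v} → Linked (word u) (word v) → v ∈ bag u
    linked-covered {u} l = ⟪⟫⁺ (holds? u) (linked-covered′ l)
    ascend′ : ∀ {l} w {v t} → occupant (l ∷ w) t ≡ v → l ∷ w ≡ v ⊎ (∃[ t ] occupant w t ≡ v)
    ascend′ {s , _} w {t = t} eq with t Fin.≟ s
    ... | yes refl = inj₁ (trans (sym (occupant-updates w)) eq)
    ... | no t≢s   = inj₂ (t , trans (sym (occupant-minimal w t≢s)) eq)
    ascend : ∀ v {u} → v ∈ bag u →
      u ≡ v ⊎ ∃[ u′ ] u′ ∈ ⟪ (λ u → v ∈? bag u) ⟫ × Graph._~_ tree u u′ × rank u′ < rank u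
    ascend v {u} v∈ with t , eq ← ⟪⟫⁻ (holds? u) v∈ | parent u
    ... | inj₁ []≡ = inj₁ (list-injective h (trans []≡ (trans (sym (cong (λ w → occupant w t) []≡)) eq)))
    ... | inj₂ (l , u′ , u≡) with ascend′ (word u′) (trans (sym (cong (λ w → occupant w t) u≡)) eq)
    ...   | inj₁ eq′  = inj₁ (list-injective h (trans u≡ eq′))
    ...   | inj₂ held = inj₂ (u′ , ⟪⟫⁺ (λ u → v ∈? bag u) (⟪⟫⁺ (holds? u′) held) , child-of u≡)

  -- A colouring of small defect yields a strategy.

  module _ {m} {f : Fin (count h) → Fin m} {d}
    (defect : Graph.HasDefect graph d f) (many : k * d < copies) where
    open Colourer m

    Represents : Colours → Word → Set
    Represents c w = ∀ t v → word v ≡ occupant w t → finToFun c t ≡ f v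

    -- If each of the copies repeats the colour of a neighbouring occupant, some
    -- occupant has more than d neighbours of its own colour.
    good-copy : ∀ w {c} → length w < h → Represents c w → ∀ s x →
      ∃[ a ] ∃[ u ] word u ≡ (s , x , a) ∷ w × Allowed (position w) c s x (f u)
    good-copy w {c} w<h rep s x
      with Fin.any? (λ a → allowed? (position w) c s x (f (proj₁ (list-surjective h {(s , x , a) ∷ w} w<h))))
    ... | yes (a , ok) = a , _ , proj₂ (list-surjective h w<h) , ok
    ... | no none = contradiction many (ℕ.≤⇒≯ copies≤)
      where
      vertex : Fin copies → Fin (count h)
      vertex a = proj₁ (list-surjective h {(s , x , a) ∷ w} w<h)
      word-vertex : ∀ a → word (vertex a) ≡ (s , x , a) ∷ w
      word-vertex a = proj₂ (list-surjective h w<h)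
      Clash : Fin copies → Slot → Set
      Clash a t = t ≢ s × Near (position w) x t × finToFun c t ≡ f (vertex a)
      clash? : ∀ a t → Dec (Clash a t)
      clash? a t = ¬? (t Fin.≟ s) ×-dec near? (position w) x t ×-dec (finToFun c t Fin.≟ f (vertex a))
      clash : ∀ a → ∃[ t ] Clash a t
      clash a with Fin.any? (clash? a)
      ... | yes found = found
      ... | no ¬found = contradiction (a , λ t t≢s near eq → ¬found (t , t≢s , near , eq)) none
      few : ∀ t → ∣ ⟪ (λ a → clash? a t) ⟫ ∣ ≤ d
      few t with v , eq ← list-surjective h {occupant w t} (ℕ.≤-trans (length-occupant w t) (ℕ.<⇒≤ w<h)) =
        ℕ.≤-trans
          (∣∣-injective-≤ _ _ (λ a u → u ≡ vertex a)
            (λ {a} a∈ → let t≢s , near , c≡ = ⟪⟫⁻ (λ a → clash? a t) a∈ in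
              vertex a ,
              ⟪⟫⁺ (λ u → Graph._~?_ graph v u ×-dec (f u Fin.≟ f v))
                ( inj₂ (subst (λ u → Linked u (word v)) (sym (word-vertex a)) (link t t≢s near eq))
                , trans (sym c≡) (rep t v eq)) ,
              refl)
            (λ {a} {a′} → λ { refl eq′ → ,-injectiveʳ (,-injectiveʳ (List.∷-injectiveˡ
               (trans (sym (word-vertex a)) (trans (cong word eq′) (word-vertex a′))))) }))
          (GraphProperties.monochromatic-degree-≤ graph {f = f} defect v)
      copies≤ : copies ≤ k * d
      copies≤ = subst (_≤ k * d) (∣⊤∣≡n copies)
        (∣∣-covering-≤ clash? d few ⊤ λ {a} _ → clash a)

    -- The reply is the colour of a good copy, and the play goes on with that copy. The bound on
    -- `length w + j` keeps every word reached among the vertices.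
    survives : ∀ j w {c} → length w + j ≤ h → Represents c w → Win j (position w) c
    survives zero    w le rep = tt
    survives (suc j) w {c} le rep s x
      with le′ ← subst (_≤ h) (ℕ.+-suc _ j) le
      with a , u , word-u , ok ← good-copy w (ℕ.≤-trans (ℕ.m≤m+n _ j) le′) rep s x =
      f u , ok , survives j ((s , x , a) ∷ w) le′ rep′
      where
      rep′ : Represents (recolour c s (f u)) ((s , x , a) ∷ w)
      rep′ t v eq with t Fin.≟ s
      ... | yes refl = trans (recolour-updates c s (f u))
        (cong f (list-injective h (trans word-u (sym (trans eq (occupant-updates w))))))
      ... | no t≢s = trans (recolour-minimal c (f u) t≢s) (rep t v (trans eq (occupant-minimal w t≢s)))

    defective⇒WinsFromStart : WinsFromStart h
    -- All slots start with the dummy, which is the vertex `root`.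
    defective⇒WinsFromStart = f root , survives h [] ℕ.≤-refl λ t v eq →
      trans (Fin.finToFun-funToFin {k} (const (f root)) t)
            (cong f (list-injective h (trans word-root (sym eq))))

-- With `suc k` slots the bags have at most `suc k` vertices, which means width at most `k`.
universal-in-class : ∀ p k copies h →
  KFreeOfTreewidth≤ (suc (suc p)) k (Universal.graph p (suc k) copies h)
universal-in-class p k copies h =
    graph-free
  , decomposition zero
  , ℕ.∸-monoˡ-≤ 1 (max≤v⁺ {xs = List.tabulate (∣_∣ ∘ bag)} z≤n (All.tabulate⁺ ∣bag∣≤k))
  where open Universal p (suc k) copies h

-- Elimination orders from tree decompositions.

-- A chordal completion of the graph in which the bag of v consists of v and of
-- its neighbours before v; the later vertices in it are irrelevant.
record Elimination (G : Graph) (k : ℕ) : Set where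
  open Graph G
  field
    pos           : Vertex → ℕ
    pos-injective : Injective _≡_ _≡_ pos
    bag           : Vertex → Subset order
    ∣bag∣≤k       : ∀ v → ∣ bag v ∣ ≤ k
    self          : ∀ v → v ∈ bag v
    edge          : ∀ {u v} → u ~ v → pos u < pos v → u ∈ bag v
    inherit       : ∀ {u v w} → w ∈ bag v → u ∈ bag v → pos w < pos u → w ∈ bag u

module TopmostNodes {G : Graph} (D : TreeDecomposition G) where
  open Graph G
  open TreeDecomposition D
  private
    module T  = Graph tree
    module TP = GraphProperties tree

  root : T.Vertex
  root = proj₁ (proj₁ (proj₁ isTree))

  opaque
    distance : ∃[ dist ] TP.IsDistanceFrom root dist
    distance = TP.connected⇒distance root λ u → proj₂ (proj₁ isTree) ∈⊤ ∈⊤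

  depth : T.Vertex → ℕ
  depth = proj₁ distance

  opaque
    topmost : ∀ v → ∃[ t ] v ∈ bag t × (∀ t′ → v ∈ bag t′ → depth t ≤ depth t′)
    topmost v = [ id , (λ none → contradiction v∈ (none _)) ]′
      (argmin depth (λ t → v ∈? bag t))
      where
      v∈ : v ∈ bag (proj₁ (proj₁ (vertex-connected v)))
      v∈ = ⟪⟫⁻ (λ t → v ∈? bag t) (proj₂ (proj₁ (vertex-connected v)))

  top : Vertex → T.Vertex
  top = proj₁ ∘ topmost

  ∈-bag-top : ∀ v → v ∈ bag (top v)
  ∈-bag-top v = proj₁ (proj₂ (topmost v))

  level : Vertex → ℕ
  level = depth ∘ top

  -- Lexicographic order by level, with ties broken by the vertex number, which is below `order`.
  pos : Vertex → ℕ
  pos v = level v * order + toℕ v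

  level-<⇒pos-< : ∀ {u v} → level u < level v → pos u < pos v
  level-<⇒pos-< {u} {v} lt = begin-strict
    level u * order + toℕ u   <⟨ ℕ.+-monoʳ-< (level u * order) (Fin.toℕ<n u) ⟩
    level u * order + order   ≡⟨ ℕ.+-comm _ order ⟩
    suc (level u) * order     ≤⟨ ℕ.*-monoˡ-≤ order lt ⟩
    level v * order           ≤⟨ ℕ.m≤m+n _ (toℕ v) ⟩
    level v * order + toℕ v   ∎
    where
    open ℕ.≤-Reasoning

  pos-<⇒level-≤ : ∀ {u v} → pos u < pos v → level u ≤ level v
  pos-<⇒level-≤ lt = ℕ.≮⇒≥ λ gt → ℕ.<-asym lt (level-<⇒pos-< gt)

  pos-injective : Injective _≡_ _≡_ pos
  pos-injective {u} {v} eq with ℕ.<-cmp (level u) (level v)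
  ... | tri< lt _ _ = contradiction eq (ℕ.<⇒≢ (level-<⇒pos-< lt))
  ... | tri> _ _ gt = contradiction (sym eq) (ℕ.<⇒≢ (level-<⇒pos-< gt))
  ... | tri≈ _ eql _ = Fin.toℕ-injective (ℕ.+-cancelˡ-≡ (level u * order) _ _
    (trans eq (cong (λ l → l * order + toℕ v) (sym eql))))

  -- The subtrees of `u` and `v` meet in `t`, and the top of `u` is no deeper than that of `v`;
  -- hence the subtree of `u` contains the top of `v`.
  earlier-in-top-bag : ∀ {u v t} → u ∈ bag t → v ∈ bag t → pos u < pos v → u ∈ bag (top v)
  earlier-in-top-bag {u} {v} {t} u∈t v∈t lt =
    ⟪⟫⁻ (λ t → u ∈? bag t) (TP.lower-subtree-contains-top (proj₂ isTree) (proj₂ distance)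
      (vertex-connected u) (vertex-connected v)
      (node u u∈t) (node v v∈t) (node u (∈-bag-top u)) (node v (∈-bag-top v))
      (λ t′ t′∈ → proj₂ (proj₂ (topmost v)) t′ (⟪⟫⁻ (λ t → v ∈? bag t) t′∈))
      (pos-<⇒level-≤ {u} {v} lt))
    where
    node : ∀ v {t} → v ∈ bag t → t ∈ nodesContaining v
    node v = ⟪⟫⁺ (λ t → v ∈? bag t)

  elimination : ∀ {k} → (∀ t → ∣ bag t ∣ ≤ k) → Elimination G k
  elimination narrow = record
    { pos = pos ; pos-injective = pos-injective ; bag = bag ∘ top
    ; ∣bag∣≤k = narrow ∘ top ; self = ∈-bag-top
    ; edge = λ u~v → let t , u∈ , v∈ = edge-covered u~v in earlier-in-top-bag u∈ v∈
    ; inherit = λ w∈ u∈ → earlier-in-top-bag w∈ u∈ }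

-- Proper colouring by following a winning strategy.

module Strategy
  {p k m j : ℕ}
  (stable : ∀ {A c} → Game.Colourer.Win (suc p) k m j A c → Game.Colourer.Win (suc p) k m (suc j) A c)
  {G : Graph} (free : (suc (suc p) -Free) G) (elimination : Elimination G k)
  where
  open Game (suc p) k
  open Colourer m
  open Graph G
  open Elimination elimination

  -- A winning position whose slots hold vertices of G, all of them before i
  -- and coloured as by f.
  record Configuration (i : ℕ) (f : Colouring m) : Set where
    field
      position : Position
      colours  : Colours
      occupant : Slot → Vertex
      winning  : Win j position colours
      agrees   : ∀ {t} → Occupied position t → finToFun colours t ≡ f (occupant t)
      before   : ∀ {t} → Occupied position t → pos (occupant t) < i
      edges    : ∀ {t t′} → t ≢ t′ → Edge position t t′ → occupant t ~ occupant t′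

    Contains : Vertex → Set
    Contains v = ∃[ t ] Occupied position t × occupant t ≡ v

  open Configuration

  Back : Vertex → Vertex → Set
  Back v u = u ∈ bag v × pos u < pos v

  -- Plays branch like the tree decomposition. Each coloured vertex therefore keeps a configuration
  -- from which the game can be resumed, and all of them agree with one colouring.
  record PartialColouring (i : ℕ) : Set where
    field
      colour : Colouring m
      proper : ∀ {u v} → pos u < i → pos v < i → u ~ v → colour u ≢ colour v
      config : ∀ {v} → pos v < i → ∃[ C ] Contains {i} {colour} C v × (∀ {u} → Back v u → Contains C u)

  module Extend {i} (P : PartialColouring i) (v : Vertex) (pos-v : pos v ≡ i)
    (C : Configuration i (PartialColouring.colour P)) (back : ∀ {u} → Back v u → Contains C u) where
    open PartialColouring P

    private
      A = position C
      o = occupant C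

    -- Such a slot can be overwritten by `v` without losing a vertex of `Back v`.
    Redundant : Slot → Set
    Redundant s = ∀ u → Back v u → ∃[ t ] t ≢ s × Occupied A t × o t ≡ u

    back? : ∀ u → Dec (Back v u)
    back? u = (u ∈? bag v) ×-dec (pos u ℕ.<? pos v)

    kept? : ∀ s u → Dec (∃[ t ] t ≢ s × Occupied A t × o t ≡ u)
    kept? s u = Fin.any? λ t → ¬? (t Fin.≟ s) ×-dec edge? A t t ×-dec (o t Fin.≟ u)

    redundant? : ∀ s → Dec (Redundant s)
    redundant? s = Fin.all? λ u → back? u →-dec kept? s u

    opaque
      -- The bag of v holds v besides the vertices of Back v, so fewer than k
      -- slots are indispensable.
      redundant-slot : ∃[ s ] Redundant s
      redundant-slot with Fin.any? redundant?
      ... | yes found = found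
      ... | no none = contradiction
        (ℕ.<-≤-trans (x∈p⇒∣p-x∣<∣p∣ (self v)) (∣bag∣≤k v))
        (ℕ.≤⇒≯ (subst (_≤ ∣ bag v - v ∣) (∣⊤∣≡n k)
          (∣∣-injective-≤ ⊤ (bag v - v) Only (λ {s} _ → needed s) only-injective)))
        where
        Only : Slot → Vertex → Set
        Only s u = Contains C u × (∀ t → Occupied A t → o t ≡ u → t ≡ s)
        only-injective : ∀ {s s′ u} → Only s u → Only s′ u → s ≡ s′
        only-injective ((t , occ , eq) , only) (_ , only′) = trans (sym (only t occ eq)) (only′ t occ eq)
        needed : ∀ s → ∃[ u ] u ∈ bag v - v × Only s u
        needed s with Fin.any? (λ u → back? u ×-dec ¬? (kept? s u))
        ... | yes (u , b@(u∈ , lt) , ¬kept) = u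
          , x∈p∧x≢y⇒x∈p-y u∈ (λ { refl → ℕ.<-irrefl refl lt })
          , back b
          , λ t occ eq → decidable-stable (t Fin.≟ s) λ t≢s → ¬kept (t , t≢s , occ , eq)
        ... | no ¬needed = contradiction
          (s , λ u b → decidable-stable (kept? s u) λ ¬kept → ¬needed (u , b , ¬kept)) none

    private
      s         = proj₁ redundant-slot
      redundant = proj₂ redundant-slot

      near-v? : ∀ t → Dec (Occupied A t × o t ~ v)
      near-v? t = edge? A t t ×-dec (o t ~? v)

      x = encode near-v?

    -- The occupants of such a clique are adjacent to `v` and to one another in `G`; with `v` they
    -- would form the forbidden clique.
    legal : ¬ Clique A x
    legal (φ , near , clique) = free (ψ , ψ-injective , λ {i′} {j′} → hom i′ j′)
      where
      ψ : Fin (suc (suc p)) → Vertex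
      ψ zero     = v
      ψ (suc i′) = o (finToFun φ i′)
      hom : ∀ i′ j′ → i′ ≢ j′ → ψ i′ ~ ψ j′
      hom zero     zero     ne = contradiction refl ne
      hom zero     (suc j′) _  = ~-sym (proj₂ (∋-encode⁻ near-v? (proj₁ (near j′))))
      hom (suc i′) zero     _  = proj₂ (∋-encode⁻ near-v? (proj₁ (near i′)))
      hom (suc i′) (suc j′) ne with t≢t′ , e ← clique i′ j′ (ne ∘ cong suc) = edges C t≢t′ e
      ψ-injective : Injective _≡_ _≡_ ψ
      -- Distinct indices have adjacent images, so equal images would make a loop.
      ψ-injective {i′} {j′} eq = decidable-stable (i′ Fin.≟ j′) λ ne →
        ~-irrefl (subst (ψ i′ ~_) (sym eq) (hom i′ j′ ne))

    opaque
      -- Stability provides one more round, so the configuration after the reply is again in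
      -- `Win j`.
      response : ∃[ y ] Allowed A (colours C) s x y × Win j (move A s x) (recolour (colours C) s y)
      response = stable {A} {colours C} (winning C) s x

    private
      y        = proj₁ response
      allowed  = proj₁ (proj₂ response)

      f′ : Colouring m
      f′ = updateAt colour v (const y)

      o′ : Slot → Vertex
      o′ = updateAt o s (const v)

      o′-updates : o′ s ≡ v
      o′-updates = updateAt-updates s o

      o′-minimal : ∀ {t} → t ≢ s → o′ t ≡ o t
      o′-minimal {t} = updateAt-minimal t s o

    unchanged : ∀ {u} → pos u < i → f′ u ≡ colour u
    unchanged {u} lt = updateAt-minimal u v colour λ { refl → ℕ.<-irrefl pos-v lt }

    recoloured : f′ v ≡ y
    recoloured = updateAt-updates v colour

    lift : Configuration i colour → Configuration (suc i) f′
    lift C′ = record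
      { position = position C′ ; colours = colours C′ ; occupant = occupant C′ ; winning = winning C′
      ; agrees = λ occ → trans (agrees C′ occ) (sym (unchanged (before C′ occ)))
      ; before = λ occ → ℕ.m<n⇒m<1+n (before C′ occ)
      ; edges = edges C′ }

    extended : Configuration (suc i) f′
    extended = record
      { position = move A s x ; colours = recolour (colours C) s y ; occupant = o′
      ; winning = proj₂ (proj₂ response)
      ; agrees = agrees′ ; before = before′ ; edges = edges′ }
      where
      agrees′ : ∀ {t} → Occupied (move A s x) t → finToFun (recolour (colours C) s y) t ≡ f′ (o′ t)
      agrees′ {t} occ with t Fin.≟ s
      ... | yes refl = trans (recolour-updates (colours C) s y) (sym (trans (cong f′ o′-updates) recoloured))
      ... | no t≢s with occ′ ← occupied-move⁻ {A} t≢s occ =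
        trans (recolour-minimal (colours C) y t≢s)
          (trans (agrees C occ′) (sym (trans (cong f′ (o′-minimal t≢s)) (unchanged (before C occ′)))))
      before′ : ∀ {t} → Occupied (move A s x) t → pos (o′ t) < suc i
      before′ {t} occ with t Fin.≟ s
      ... | yes refl = s≤s (ℕ.≤-reflexive (trans (cong pos o′-updates) pos-v))
      ... | no t≢s = ℕ.m<n⇒m<1+n
        (subst (λ u → pos u < i) (sym (o′-minimal t≢s)) (before C (occupied-move⁻ {A} t≢s occ)))
      edges′ : ∀ {t t′} → t ≢ t′ → Edge (move A s x) t t′ → o′ t ~ o′ t′
      edges′ t≢t′ e with Edge-relation⁻ (moved? A s x) e
      ... | new = contradiction refl t≢t′
      ... | out t′≢s (x∋ , _) =
        subst₂ _~_ (sym o′-updates) (sym (o′-minimal t′≢s)) (~-sym (proj₂ (∋-encode⁻ near-v? x∋)))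
      ... | into t≢s (x∋ , _) =
        subst₂ _~_ (sym (o′-minimal t≢s)) (sym o′-updates) (proj₂ (∋-encode⁻ near-v? x∋))
      ... | old t≢s t′≢s e′ =
        subst₂ _~_ (sym (o′-minimal t≢s)) (sym (o′-minimal t′≢s)) (edges C t≢t′ e′)

    extended-contains : Contains extended v × (∀ {u} → Back v u → Contains extended u)
    extended-contains = (s , Edge-relation⁺ (moved? A s x) new , o′-updates) , contains
      where
      contains : ∀ {u} → Back v u → Contains extended u
      contains b with t , t≢s , occ , eq ← redundant _ b =
        t , Edge-relation⁺ (moved? A s x) (old t≢s t≢s occ) , trans (o′-minimal t≢s) eq

    earlier : ∀ {u} → pos u < suc i → u ≡ v ⊎ pos u < i
    earlier lt with ℕ.m≤n⇒m<n∨m≡n (s≤s⁻¹ lt)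
    ... | inj₁ lt′ = inj₂ lt′
    ... | inj₂ eq  = inj₁ (pos-injective (trans eq (sym pos-v)))

    -- An earlier neighbour of `v` lies in `Back v` and so is held by a slot other than `s`. The
    -- move selects that slot, and the reply avoids its colour.
    differs : ∀ {u} → pos u < i → u ~ v → f′ u ≢ f′ v
    differs {u} lt u~v eq
      with lt′ ← subst (pos u <_) (sym pos-v) lt
      with t , t≢s , occ , refl ← redundant u (edge u~v lt′ , lt′) =
      allowed t t≢s (∋-encode⁺ near-v? (occ , u~v) , occ , legal)
        (trans (agrees C occ) (trans (sym (unchanged lt)) (trans eq recoloured)))

    extend : PartialColouring (suc i)
    extend = record { colour = f′ ; proper = proper′ ; config = config′ }
      where
      proper′ : ∀ {u w} → pos u < suc i → pos w < suc i → u ~ w → f′ u ≢ f′ w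
      proper′ ltᵤ lt_w u~w with earlier ltᵤ | earlier lt_w
      ... | inj₁ refl | inj₁ refl = contradiction u~w ~-irrefl
      ... | inj₁ refl | inj₂ lt   = differs lt (~-sym u~w) ∘ sym
      ... | inj₂ lt   | inj₁ refl = differs lt u~w
      ... | inj₂ lt   | inj₂ lt′  = λ eq →
        proper lt lt′ u~w (trans (sym (unchanged lt)) (trans eq (unchanged lt′)))
      config′ : ∀ {u} → pos u < suc i → ∃[ C ] Contains {suc i} {f′} C u × (∀ {w} → Back u w → Contains C w)
      config′ lt with earlier lt
      ... | inj₁ refl = extended , extended-contains
      ... | inj₂ lt′ with C′ , c , cs ← config lt′ = lift C′ , c , cs

  module _ {y₀} (win₀ : Win j vacant (start y₀)) where

    colour-next : ∀ {i} → PartialColouring i → PartialColouring (suc i)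
    colour-next {i} P with Fin.any? (λ v → pos v ℕ.≟ i)
    -- Values of `pos` may have gaps; at a gap nothing is coloured.
    ... | no none = record
      { colour = colour
      ; proper = λ lt lt′ → proper (skip lt) (skip lt′)
      ; config = λ lt → let C , c , cs = config (skip lt) in weaken C , c , cs }
      where
      open PartialColouring P
      skip : ∀ {u} → pos u < suc i → pos u < i
      skip lt = ℕ.≤∧≢⇒< (s≤s⁻¹ lt) λ eq → none (_ , eq)
      weaken : Configuration i colour → Configuration (suc i) colour
      weaken C = record { Configuration C ; before = ℕ.m<n⇒m<1+n ∘ before C }
    -- The game is resumed from the configuration of the last vertex `u` of `Back v`: by `inherit`,
    -- the rest of `Back v` lies in `Back u`.
    ... | yes (v , pos-v) with argmax pos (λ u → (u ∈? bag v) ×-dec (pos u ℕ.<? pos v))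
    ...   | inj₂ none = Extend.extend P v pos-v initial λ {u} b → contradiction b (none u)
      where
      -- With nothing before `v` in its bag a new play begins; all slots are vacant, so their
      -- occupant is arbitrary.
      initial = record
        { position = vacant ; colours = start y₀ ; occupant = const v ; winning = win₀
        ; agrees = λ {t} occ → contradiction occ (¬Edge-vacant t t)
        ; before = λ {t} occ → contradiction occ (¬Edge-vacant t t)
        ; edges = λ {t} {t′} _ e → contradiction e (¬Edge-vacant t t′) }
    ...   | inj₁ (u , (u∈ , lt) , last) with PartialColouring.config P (subst (pos u <_) pos-v lt)
    ...     | C , c , cs = Extend.extend P v pos-v C back
      where
      back : ∀ {w} → Back v w → Contains C w
      back {w} b@(w∈ , _) with ℕ.m≤n⇒m<n∨m≡n (last w b)
      ... | inj₁ lt′ = cs (inherit w∈ u∈ lt′ , lt′)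
      ... | inj₂ eq  = subst (Contains C) (sym (pos-injective eq)) c

    colour-first : ∀ i → PartialColouring i
    colour-first zero    = record { colour = const y₀ ; proper = λ () ; config = λ () }
    colour-first (suc i) = colour-next (colour-first i)

    proper-colouring : ∃[ f ] IsProper {k = m} f
    proper-colouring with b , pos<b ← bounded pos with P ← colour-first b =
      PartialColouring.colour P , PartialColouring.proper P (pos<b _) (pos<b _)

-- The three chromatic numbers as the least sufficient number of colours.

∣bag∣≤1+width : ∀ {G} (D : TreeDecomposition G) {k} → TreeDecomposition.width D ≤ k →
  ∀ t → ∣ TreeDecomposition.bag D t ∣ ≤ suc k
∣bag∣≤1+width D {k} width≤k t =
  ℕ.≤-trans (All.tabulate⁻ (xs≤max 0 (List.tabulate λ t → ∣ TreeDecomposition.bag D t ∣)) t)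
    (ℕ.≤-trans (ℕ.m≤n+m∸n _ 1) (s≤s width≤k))

module Classes (p k : ℕ) where
  open Game (suc p) (suc k)

  𝒢 : GraphClass
  𝒢 = KFreeOfTreewidth≤ (suc (suc p)) k

  opaque
    horizon : ℕ → ℕ
    horizon m = proj₁ (Colourer.Win-stabilises m)

    stable : ∀ m {A c} → Colourer.Win m (horizon m) A c → Colourer.Win m (suc (horizon m)) A c
    stable m = proj₂ (Colourer.Win-stabilises m)

  -- By `stable`, surviving `horizon m` rounds amounts to surviving for ever.
  Sufficient : ℕ → Set
  Sufficient m = Colourer.WinsFromStart m (horizon m)

  sufficient? : ∀ m → Dec (Sufficient m)
  sufficient? m = Colourer.winsFromStart? m (horizon m)

  sufficient⇒proper : ∀ {m} → Sufficient m → ∀ {G} → 𝒢 G → ∃[ f ] Graph.IsProper G {m} f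
  sufficient⇒proper {m} (_ , win) (free , D , width≤k) =
    Strategy.proper-colouring (stable m) free
      (TopmostNodes.elimination D (∣bag∣≤1+width D width≤k)) win

  opaque
    witness : (m d : ℕ) → Graph
    -- At defect `d` each of the `suc k` slots spoils at most `d` copies, so one copy more leaves a
    -- good one.
    witness m d = Universal.graph p (suc k) (suc (suc k * d)) (horizon m)

    witness∈𝒢 : ∀ m d → 𝒢 (witness m d)
    witness∈𝒢 m d = universal-in-class p k _ (horizon m)

    defective⇒sufficient : ∀ m {d} → (∃[ f ] Graph.HasDefect (witness m d) {m} d f) → Sufficient m
    defective⇒sufficient m (f , defect) =
      Universal.defective⇒WinsFromStart p (suc k) _ (horizon m) {f = f} defect ℕ.≤-refl

  proper⇒sufficient : ∀ m → (∃[ f ] Graph.IsProper (witness m 0) {m} f) → Sufficient m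
  proper⇒sufficient m (f , proper) =
    defective⇒sufficient m (f , GraphProperties.proper⇒HasDefect-0 (witness m 0) proper)

  least-sufficient : ∃[ n ] IsMinimum Sufficient n
  least-sufficient = least sufficient? (suc (suc k)) (zero , suc-k-colours-win (horizon (suc (suc k))))

  module _ {n} (sufficient : Sufficient n) (minimal : ∀ m → Sufficient m → n ≤ m) where

    defective-number : IsDefectiveChromaticNumber 𝒢 n
    defective-number =
        (0 , λ G G∈ → let f , proper = sufficient⇒proper sufficient G∈ in
          f , GraphProperties.proper⇒HasDefect-0 G proper)
      , λ m (d , colourable) → minimal m (defective⇒sufficient m (colourable (witness m d) (witness∈𝒢 m d)))

    clustered-number : IsClusteredChromaticNumber 𝒢 n
    clustered-number =
        (1 , λ G G∈ → let f , proper = sufficient⇒proper sufficient G∈ in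
          f , GraphProperties.proper⇒HasClustering-1 G proper)
      , λ m (c , colourable) → minimal m (defective⇒sufficient m
          (let f , clustered = colourable (witness m c) (witness∈𝒢 m c)
           in f , GraphProperties.HasClustering⇒HasDefect (witness m c) {f = f} clustered))

  -- The witness against one colour fewer, at defect 0: a proper colouring of it with fewer than the
  -- least sufficient number of colours would contradict minimality.
  extremal-graph : ∀ {n} → Sufficient n → (∀ m → Sufficient m → n ≤ m) →
    ∃[ G ] 𝒢 G × Graph.IsChromaticNumber G n
  -- Without colours there is no initial colour for the slots.
  extremal-graph {zero}  (() , _)
  extremal-graph {suc n} sufficient minimal =
    witness n 0 , witness∈𝒢 n 0 , sufficient⇒proper sufficient (witness∈𝒢 n 0) , λ m (f , proper) →
      ℕ.≰⇒> λ m≤n → ℕ.1+n≰n (minimal n (proper⇒sufficient n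
        ((λ v → inject≤ (f v) m≤n) , λ u~v → proper u~v ∘ Fin.inject≤-injective m≤n m≤n _ _)))

  chromatic-number : ∀ {n} → Sufficient n → (∀ m → Sufficient m → n ≤ m) → IsClassChromaticNumber 𝒢 n
  chromatic-number sufficient minimal =
      extremal-graph sufficient minimal
    , λ m (G , G∈ , _ , m-minimal) → m-minimal _ (sufficient⇒proper sufficient G∈)

theorem13 : ∀ (p k : ℕ) → 3 ≤ p → 1 ≤ k →
    ∃[ n ] IsDefectiveChromaticNumber (KFreeOfTreewidth≤ p k) n
         × IsClusteredChromaticNumber (KFreeOfTreewidth≤ p k) n
         × IsClassChromaticNumber (KFreeOfTreewidth≤ p k) n
theorem13 (suc zero)    k (s≤s ()) _
theorem13 (suc (suc p)) k _ _ =
  let n , sufficient , minimal = least-sufficient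
  in n , defective-number sufficient minimal
       , clustered-number sufficient minimal
       , chromatic-number sufficient minimal
  where
  open Classes p k
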